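{- The set $I_{XTD} = \{e : \mathrm{XTD}(\mathcal L_e) < \infty\}$ is $\Sigma^0_3$-complete.
   Context: $W_0,W_1,\ldots$ is an acceptable numbering of all r.e. subsets of $\mathbb N$; $L^e_j = \{x : \langle j,x\rangle \in W_e\}$ and $\mathcal L_e = \{L^e_j : j\in\mathbb N\}$. For a family $\mathcal L$ of subsets of $\mathbb N$ and any $L\subseteq\mathbb N$, a set $S\subseteq\mathbb N$ is a specifying set for $L$ w.r.t. $\mathcal L$ iff there is at most one $L'\in\mathcal L$ with $L\cap S = L'\cap S$. The extended teaching dimension $\mathrm{XTD}(\mathcal L)$ is $\inf\{d : \text{every } L\subseteq\mathbb N \text{ has a specifying set w.r.t. } \mathcal L \text{ of at most } d \text{ elements}\}$ (with $\inf\emptyset=\infty$). $\Sigma^0_n$-complete means definable by a $\Sigma^0_n$ formula and every $\Sigma^0_n$ set many-one reduces to it via a recursive function. -}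

module Defs where

open import Level using (Level; _⊔_) renaming (suc to lsuc)
open import Data.Nat using (ℕ; zero; suc; _+_; _≤_; _<_)
open import Data.Product using (Σ; ∃; _×_; _,_; proj₁; proj₂)
open import Data.List using (List; length)
open import Data.List.Membership.Propositional using (_∈_)
open import Function.Bundles using (_⇔_)
open import Relation.Binary.PropositionalEquality using (_≡_)

tri : ℕ → ℕ
tri zero    = 0
tri (suc k) = tri k + suc k

⟨_,_⟩ : ℕ → ℕ → ℕ
⟨ x , y ⟩ = tri (x + y) + y

nextPair : ℕ × ℕ → ℕ × ℕ
nextPair (suc x , y) = (x , suc y)
nextPair (zero  , y) = (suc y , 0)

unpair : ℕ → ℕ × ℕ
unpair zero    = (0 , 0)
unpair (suc n) = nextPair (unpair n)

π₁ π₂ : ℕ → ℕ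
π₁ n = proj₁ (unpair n)
π₂ n = proj₂ (unpair n)

data Code : Set where
  cZero cSucc cId cFst cSnd : Code
  cPair cComp cRec           : Code → Code → Code
  cMu                        : Code → Code

data Eval : Code → ℕ → ℕ → Set where
  eZero : ∀ {x} → Eval cZero x 0
  eSucc : ∀ {x} → Eval cSucc x (suc x)
  eId   : ∀ {x} → Eval cId x x
  eFst  : ∀ {x} → Eval cFst x (π₁ x)
  eSnd  : ∀ {x} → Eval cSnd x (π₂ x)
  ePair : ∀ {f g x a b} → Eval f x a → Eval g x b → Eval (cPair f g) x ⟨ a , b ⟩
  eComp : ∀ {f g x a b} → Eval g x a → Eval f a b → Eval (cComp f g) x b
  eRec0 : ∀ {f g x a} → Eval f x a → Eval (cRec f g) ⟨ x , 0 ⟩ a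
  eRecS : ∀ {f g x n a b} → Eval (cRec f g) ⟨ x , n ⟩ a →
          Eval g ⟨ x , ⟨ n , a ⟩ ⟩ b → Eval (cRec f g) ⟨ x , suc n ⟩ b
  eMu   : ∀ {f x n} → Eval f ⟨ x , n ⟩ 0 →
          (∀ m → m < n → ∃ λ k → Eval f ⟨ x , m ⟩ (suc k)) →
          Eval (cMu f) x n

-- Gödel numbering of codes (with fuel; decode n uses fuel n, which suffices)
decodeF : ℕ → ℕ → Code
decodeF zero       n = cZero
decodeF (suc fuel) n with unpair n
... | (0 , r) = cZero
... | (1 , r) = cSucc
... | (2 , r) = cId
... | (3 , r) = cFst
... | (4 , r) = cSnd
... | (5 , r) = cPair (decodeF fuel (π₁ r)) (decodeF fuel (π₂ r))
... | (6 , r) = cComp (decodeF fuel (π₁ r)) (decodeF fuel (π₂ r))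
... | (7 , r) = cRec (decodeF fuel (π₁ r)) (decodeF fuel (π₂ r))
... | (8 , r) = cMu (decodeF fuel r)
... | (_ , r) = cZero

decode : ℕ → Code
decode n = decodeF n n

φStd : ℕ → ℕ → ℕ → Set
φStd e x y = Eval (decode e) x y

Recursive : (ℕ → ℕ) → Set
Recursive f = ∃ λ c → ∀ x → Eval (decode c) x (f x)

RecursiveSet : (ℕ → Set) → Set
RecursiveSet A = ∃ λ (χ : ℕ → ℕ) → Recursive χ × (∀ x → A x ⇔ (χ x ≡ 0))

Σ⁰₃ : ∀ {a} → (ℕ → Set a) → Set (lsuc Level.zero ⊔ a)
Σ⁰₃ A = ∃ λ (R : ℕ → Set) → RecursiveSet R ×
        (∀ e → A e ⇔ (∃ λ x → ∀ y → ∃ λ z → R ⟨ e , ⟨ x , ⟨ y , z ⟩ ⟩ ⟩))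

_≤ₘ_ : ∀ {a b} → (ℕ → Set b) → (ℕ → Set a) → Set (a ⊔ b)
B ≤ₘ A = ∃ λ f → Recursive f × (∀ x → B x ⇔ A (f x))

Σ⁰₃-complete : ∀ {a} → (ℕ → Set a) → Set (lsuc Level.zero ⊔ a)
Σ⁰₃-complete A = Σ⁰₃ A × (∀ (B : ℕ → Set) → Σ⁰₃ B → B ≤ₘ A)

Numbering : Set₁
Numbering = ℕ → ℕ → ℕ → Set   -- φ e x y : "φ_e(x) = y"

Acceptable : Numbering → Set
Acceptable φ =
  (∃ λ t → Recursive t × (∀ e x y → φ e x y ⇔ φStd (t e) x y)) ×
  (∃ λ s → Recursive s × (∀ e x y → φStd e x y ⇔ φ (s e) x y))

W : Numbering → ℕ → ℕ → Set
W φ e x = ∃ λ y → φ e x y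

Lang : Numbering → ℕ → ℕ → ℕ → Set
Lang φ e j x = W φ e ⟨ j , x ⟩

SameSet : (ℕ → Set) → (ℕ → Set) → Set
SameSet A B = ∀ x → A x ⇔ B x

AgreeOn : List ℕ → (ℕ → Set) → (ℕ → Set) → Set
AgreeOn S A B = ∀ x → x ∈ S → A x ⇔ B x

Specifying : (ℕ → ℕ → Set) → (ℕ → Set) → List ℕ → Set
Specifying 𝓛 L S = ∀ j j' → AgreeOn S L (𝓛 j) → AgreeOn S L (𝓛 j') → SameSet (𝓛 j) (𝓛 j')

XTDFinite : (ℕ → ℕ → Set) → Set₁
XTDFinite 𝓛 = ∃ λ d → ∀ (L : ℕ → Set) → ∃ λ S → length S ≤ d × Specifying 𝓛 L S

I-XTD : Numbering → ℕ → Set₁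
I-XTD φ e = XTDFinite (Lang φ e)

{-# OPTIONS --safe #-}
-- XTD(𝓛) is finite iff 𝓛 is finite, that is, iff for some n the members of 𝓛 are determined by their
-- restrictions to [0, n). If no n works, a compactness (König) argument yields a set L all of whose
-- initial segments are shared by two distinct members of 𝓛, so L has no finite specifying set.
--
-- Upper bound: "agreeing on [0, n) implies equal" is a Boolean combination of r.e. conditions with
-- finitely many instances, so it holds iff its finite-stage approximation holds at infinitely many
-- stages, which is a ∀∃ condition. Finite stages are provided by a stack machine interpreting codes.
--
-- Hardness: given B = {x : ∃a ∀b ∃c R(x,a,b,c)}, let L_j consist of [0, j) and of those y ≥ j for which
-- some a ≤ j satisfies ∀ b ≤ y − j ∃c R(x,a,b,c). Each L_j is an initial segment of ℕ. If a witnesses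
-- x ∈ B, then L_j = ℕ for all j ≥ a; otherwise every L_j is finite, and they grow unboundedly.
module Submission where

open import Defs
open import Level using (0ℓ) renaming (suc to lsuc)
open import Axiom.ExcludedMiddle using (ExcludedMiddle)
open import Data.List using (List; []; _∷_; upTo)
open import Data.List.Membership.Propositional using (_∈_)
open import Data.List.Membership.Propositional.Properties using (∈-upTo⁺)
open import Data.List.Properties using (length-upTo)
open import Data.List.Relation.Unary.Any using (here; there)
open import Data.Nat using (ℕ; zero; suc; _+_; _∸_; _⊔_; _≤_; _<_; z≤n; s≤s; pred)
open import Data.Nat.Properties
open import Data.Product using (∃; _×_; _,_; proj₁; proj₂)
open import Data.Sum using (_⊎_; inj₁; inj₂; [_,_]′)
open import Data.Unit using (⊤; tt)
open import Function.Base using (_∘_; id; case_of_)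
open import Function.Bundles using (_⇔_; mk⇔; Equivalence)
open import Function.Properties.Equivalence
  renaming (refl to ⇔-refl; sym to ⇔-sym; trans to ⇔-trans) using ()
open import Relation.Binary.PropositionalEquality
open import Relation.Nullary using (¬_; yes; no; contradiction)
open Equivalence using (to; from)

-- The Cantor pairing function and its inverse

pair-next : ∀ p → ⟨ proj₁ (nextPair p) , proj₂ (nextPair p) ⟩ ≡ suc ⟨ proj₁ p , proj₂ p ⟩
pair-next (zero  , y) = trans (+-identityʳ _)
  (trans (cong tri (+-identityʳ (suc y))) (+-suc (tri y) y))
pair-next (suc x , y) = trans (+-suc _ y) (cong (λ k → suc (tri k + y)) (+-suc x y))

pair-unpair : ∀ n → ⟨ π₁ n , π₂ n ⟩ ≡ n
pair-unpair zero    = refl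
pair-unpair (suc n) = trans (pair-next (unpair n)) (cong suc (pair-unpair n))

-- Induction along the enumeration by `nextPair`: a nonzero pair is the successor of `(0 , x)` or of
-- `(suc x , y)`, whose code is `n` by `pair-next`.
unpair-unique : ∀ n x y → ⟨ x , y ⟩ ≡ n → unpair n ≡ (x , y)
unpair-unique zero    zero    zero    eq = refl
unpair-unique zero    zero    (suc y) eq = contradiction (m+n≡0⇒n≡0 (tri (suc y)) eq) λ ()
unpair-unique zero    (suc x) y       eq =
  contradiction (m+n≡0⇒n≡0 (tri (x + y)) (m+n≡0⇒m≡0 (tri (suc x + y)) eq)) λ ()
unpair-unique (suc n) zero    zero    ()
unpair-unique (suc n) (suc x) zero    eq =
  cong nextPair (unpair-unique n zero x (suc-injective (trans (sym (pair-next (zero , x))) eq)))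
unpair-unique (suc n) x       (suc y) eq =
  cong nextPair (unpair-unique n (suc x) y (suc-injective (trans (sym (pair-next (suc x , y))) eq)))

unpair-pair : ∀ x y → unpair ⟨ x , y ⟩ ≡ (x , y)
unpair-pair x y = unpair-unique _ x y refl

π₁-pair : ∀ x y → π₁ ⟨ x , y ⟩ ≡ x
π₁-pair x y = cong proj₁ (unpair-pair x y)

π₂-pair : ∀ x y → π₂ ⟨ x , y ⟩ ≡ y
π₂-pair x y = cong proj₂ (unpair-pair x y)

≤tri : ∀ n → n ≤ tri n
≤tri zero    = z≤n
≤tri (suc n) = m≤n+m (suc n) (tri n)

π₁≤ : ∀ n → π₁ n ≤ n
π₁≤ n = subst (π₁ n ≤_) (pair-unpair n)
  (≤-trans (m≤m+n (π₁ n) (π₂ n)) (≤-trans (≤tri _) (m≤m+n _ (π₂ n))))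

π₂≤ : ∀ n → π₂ n ≤ n
π₂≤ n = subst (π₂ n ≤_) (pair-unpair n) (m≤n+m (π₂ n) _)

π₂< : ∀ n {t} → π₁ n ≡ suc t → π₂ n < n
π₂< n {t} eq = subst (π₂ n <_) (pair-unpair n) (+-monoˡ-≤ (π₂ n) 1≤tri)
  where
  1≤tri : 1 ≤ tri (π₁ n + π₂ n)
  1≤tri = ≤-trans (subst (λ k → 1 ≤ k + π₂ n) (sym eq) (s≤s z≤n)) (≤tri _)

-- Unfolding the numbering of codes

expand : (ℕ → Code) → ℕ → ℕ → Code
expand D 0 r = cZero
expand D 1 r = cSucc
expand D 2 r = cId
expand D 3 r = cFst
expand D 4 r = cSnd
expand D 5 r = cPair (D (π₁ r)) (D (π₂ r))
expand D 6 r = cComp (D (π₁ r)) (D (π₂ r))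
expand D 7 r = cRec (D (π₁ r)) (D (π₂ r))
expand D 8 r = cMu (D r)
expand D (suc (suc (suc (suc (suc (suc (suc (suc (suc t))))))))) r = cZero

decodeF-suc : ∀ k n → decodeF (suc k) n ≡ expand (decodeF k) (π₁ n) (π₂ n)
decodeF-suc k n with unpair n
... | (0 , r) = refl
... | (1 , r) = refl
... | (2 , r) = refl
... | (3 , r) = refl
... | (4 , r) = refl
... | (5 , r) = refl
... | (6 , r) = refl
... | (7 , r) = refl
... | (8 , r) = refl
... | (suc (suc (suc (suc (suc (suc (suc (suc (suc t)))))))) , r) = refl

expand-cong : ∀ {D D'} t r → (∀ m → m ≤ r → D m ≡ D' m) → expand D t r ≡ expand D' t r
expand-cong 0 r h = refl
expand-cong 1 r h = refl
expand-cong 2 r h = refl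
expand-cong 3 r h = refl
expand-cong 4 r h = refl
expand-cong 5 r h = cong₂ cPair (h _ (π₁≤ r)) (h _ (π₂≤ r))
expand-cong 6 r h = cong₂ cComp (h _ (π₁≤ r)) (h _ (π₂≤ r))
expand-cong 7 r h = cong₂ cRec (h _ (π₁≤ r)) (h _ (π₂≤ r))
expand-cong 8 r h = cong cMu (h _ ≤-refl)
expand-cong (suc (suc (suc (suc (suc (suc (suc (suc (suc t))))))))) r h = refl

-- Immediate subcodes have numbers at most `π₂ n`, which is below `n` when the tag is nonzero, so
-- fuel `n` never runs out. Tag 0 makes no recursive call.
decodeF-fuel : ∀ k l n → n ≤ k → n ≤ l → decodeF k n ≡ decodeF l n
decodeF-fuel zero    zero    n       n≤k n≤l = refl
decodeF-fuel zero    (suc l) zero    n≤k n≤l = refl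
decodeF-fuel (suc k) zero    zero    n≤k n≤l = refl
decodeF-fuel (suc k) (suc l) n       n≤k n≤l =
  trans (decodeF-suc k n) (trans (go (π₁ n) refl) (sym (decodeF-suc l n)))
  where
  go : ∀ t → π₁ n ≡ t → expand (decodeF k) t (π₂ n) ≡ expand (decodeF l) t (π₂ n)
  go zero    eq = refl
  go (suc t) eq = expand-cong (suc t) (π₂ n) λ m m≤ →
    decodeF-fuel k l m (bound n≤k m≤) (bound n≤l m≤)
    where
    bound : ∀ {j m} → n ≤ suc j → m ≤ π₂ n → m ≤ j
    bound n≤ m≤ = ≤-trans m≤ (≤-pred (≤-trans (π₂< n eq) n≤))

decode-expand : ∀ n → decode n ≡ expand decode (π₁ n) (π₂ n)
decode-expand n = trans (decodeF-fuel n (suc n) n ≤-refl (n≤1+n n))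
  (trans (decodeF-suc n n) (expand-cong (π₁ n) (π₂ n) λ m m≤ →
    decodeF-fuel n m m (≤-trans m≤ (π₂≤ n)) ≤-refl))

decode-tag : ∀ t r → decode ⟨ t , r ⟩ ≡ expand decode t r
decode-tag t r = trans (decode-expand ⟨ t , r ⟩) (cong₂ (expand decode) (π₁-pair t r) (π₂-pair t r))

decode-pair : ∀ a b → decode ⟨ 5 , ⟨ a , b ⟩ ⟩ ≡ cPair (decode a) (decode b)
decode-pair a b = trans (decode-tag 5 ⟨ a , b ⟩)
  (cong₂ (λ x y → cPair (decode x) (decode y)) (π₁-pair a b) (π₂-pair a b))

decode-comp : ∀ a b → decode ⟨ 6 , ⟨ a , b ⟩ ⟩ ≡ cComp (decode a) (decode b)
decode-comp a b = trans (decode-tag 6 ⟨ a , b ⟩)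
  (cong₂ (λ x y → cComp (decode x) (decode y)) (π₁-pair a b) (π₂-pair a b))

decode-rec : ∀ a b → decode ⟨ 7 , ⟨ a , b ⟩ ⟩ ≡ cRec (decode a) (decode b)
decode-rec a b = trans (decode-tag 7 ⟨ a , b ⟩)
  (cong₂ (λ x y → cRec (decode x) (decode y)) (π₁-pair a b) (π₂-pair a b))

-- Abstract because the numbers of concrete codes are far too large to be computed in unary.
abstract
  decode-surjective : ∀ c → ∃ λ n → decode n ≡ c
  decode-surjective cZero = 0 , refl
  decode-surjective cSucc = ⟨ 1 , 0 ⟩ , decode-tag 1 0
  decode-surjective cId   = ⟨ 2 , 0 ⟩ , decode-tag 2 0
  decode-surjective cFst  = ⟨ 3 , 0 ⟩ , decode-tag 3 0
  decode-surjective cSnd  = ⟨ 4 , 0 ⟩ , decode-tag 4 0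
  decode-surjective (cPair f g) with decode-surjective f | decode-surjective g
  ... | a , p | b , q = ⟨ 5 , ⟨ a , b ⟩ ⟩ , trans (decode-pair a b) (cong₂ cPair p q)
  decode-surjective (cComp f g) with decode-surjective f | decode-surjective g
  ... | a , p | b , q = ⟨ 6 , ⟨ a , b ⟩ ⟩ , trans (decode-comp a b) (cong₂ cComp p q)
  decode-surjective (cRec f g) with decode-surjective f | decode-surjective g
  ... | a , p | b , q = ⟨ 7 , ⟨ a , b ⟩ ⟩ , trans (decode-rec a b) (cong₂ cRec p q)
  decode-surjective (cMu f) with decode-surjective f
  ... | a , p = ⟨ 8 , a ⟩ , trans (decode-tag 8 a) (cong cMu p)

-- Primitive recursion as a typed combinator language

record Total : Set where
  field
    raw  : ℕ → ℕ
    code : Code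
    runs : ∀ n → Eval code n (raw n)

open Total

compT : Total → Total → Total
compT g f = record
  { raw  = raw g ∘ raw f
  ; code = cComp (code g) (code f)
  ; runs = λ n → eComp (runs f n) (runs g (raw f n)) }

pairT : Total → Total → Total
pairT f g = record
  { raw  = λ n → ⟨ raw f n , raw g n ⟩
  ; code = cPair (code f) (code g)
  ; runs = λ n → ePair (runs f n) (runs g n) }

idT zeroT sucT fstT sndT : Total
idT   = record { raw = id       ; code = cId   ; runs = λ _ → eId }
zeroT = record { raw = λ _ → 0  ; code = cZero ; runs = λ _ → eZero }
sucT  = record { raw = suc      ; code = cSucc ; runs = λ _ → eSucc }
fstT  = record { raw = π₁       ; code = cFst  ; runs = λ _ → eFst }
sndT  = record { raw = π₂       ; code = cSnd  ; runs = λ _ → eSnd }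

primRec : (ℕ → ℕ) → (ℕ → ℕ) → ℕ → ℕ → ℕ
primRec f g x zero    = f x
primRec f g x (suc n) = g ⟨ x , ⟨ n , primRec f g x n ⟩ ⟩

recT : Total → Total → Total
recT f g = record
  { raw  = λ n → primRec (raw f) (raw g) (π₁ n) (π₂ n)
  ; code = cRec (code f) (code g)
  ; runs = λ n → subst (λ m → Eval (cRec (code f) (code g)) m (primRec (raw f) (raw g) (π₁ n) (π₂ n)))
                       (pair-unpair n) (go (π₁ n) (π₂ n)) }
  where
  go : ∀ x n → Eval (cRec (code f) (code g)) ⟨ x , n ⟩ (primRec (raw f) (raw g) x n)
  go x zero    = eRec0 {x = x} (runs f x)
  go x (suc n) = eRecS {x = x} {n = n} (go x n) (runs g ⟨ x , ⟨ n , primRec (raw f) (raw g) x n ⟩ ⟩)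

recT-pair : ∀ f g x n → raw (recT f g) ⟨ x , n ⟩ ≡ primRec (raw f) (raw g) x n
recT-pair f g x n = cong₂ (primRec (raw f) (raw g)) (π₁-pair x n) (π₂-pair x n)

-- Primitive recursion whose step forgets the previous value: it passes only ⟨x , n⟩ on to `g`.
caseT : Total → Total → Total
caseT f g = recT f (compT g (pairT fstT (compT fstT sndT)))

caseT-zero : ∀ f g x → raw (caseT f g) ⟨ x , 0 ⟩ ≡ raw f x
caseT-zero f g x = recT-pair f (compT g (pairT fstT (compT fstT sndT))) x 0

caseT-suc : ∀ f g x n → raw (caseT f g) ⟨ x , suc n ⟩ ≡ raw g ⟨ x , n ⟩
caseT-suc f g x n = trans (recT-pair f h x (suc n))
  (cong₂ (λ a b → raw g ⟨ a , b ⟩) (π₁-pair x ⟨ n , m ⟩)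
    (trans (cong π₁ (π₂-pair x ⟨ n , m ⟩)) (π₁-pair n m)))
  where
  h = compT g (pairT fstT (compT fstT sndT))
  m = primRec (raw f) (raw h) x n

infixr 6 _⊗_
infixr 5 _⊕_
data Ty : Set where
  nat     : Ty
  _⊗_ _⊕_ : Ty → Ty → Ty
  list    : Ty → Ty

El : Ty → Set
El nat      = ℕ
El (A ⊗ B)  = El A × El B
El (A ⊕ B)  = El A ⊎ El B
El (list A) = List (El A)

enc : ∀ {A} → El A → ℕ
-- The successor keeps nonempty lists apart from 0 and turns `consF` into the successor function, so
-- case distinction on lists is case distinction on numbers.
encList : ∀ {A} → List (El A) → ℕ

enc {nat}    n        = n
enc {A ⊗ B}  (a , b)  = ⟨ enc a , enc b ⟩
enc {A ⊕ B}  (inj₁ a) = ⟨ 0 , enc a ⟩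
enc {A ⊕ B}  (inj₂ b) = ⟨ 1 , enc b ⟩
enc {list A} as       = encList as

encList []       = 0
encList (a ∷ as) = suc ⟨ enc a , encList as ⟩

-- The underlying program is total on all numbers, since primitive recursion also visits inputs that
-- do not encode elements of A.
record Fn (A B : Ty) : Set where
  field
    tot : Total
    fn  : El A → El B
    ok  : ∀ a → raw tot (enc a) ≡ enc (fn a)

open Fn

infixr 9 _∙_
_∙_ : ∀ {A B C} → Fn B C → Fn A B → Fn A C
g ∙ f = record
  { tot = compT (tot g) (tot f)
  ; fn  = λ a → fn g (fn f a)
  ; ok  = λ a → trans (cong (raw (tot g)) (ok f a)) (ok g (fn f a)) }

infixr 4 _,F_
_,F_ : ∀ {A B C} → Fn A B → Fn A C → Fn A (B ⊗ C)
f ,F g = record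
  { tot = pairT (tot f) (tot g)
  ; fn  = λ a → fn f a , fn g a
  ; ok  = λ a → cong₂ ⟨_,_⟩ (ok f a) (ok g a) }

idF : ∀ {A} → Fn A A
idF = record { tot = idT ; fn = id ; ok = λ _ → refl }

fstF : ∀ {A B} → Fn (A ⊗ B) A
fstF = record { tot = fstT ; fn = proj₁ ; ok = λ (a , b) → π₁-pair (enc a) (enc b) }

sndF : ∀ {A B} → Fn (A ⊗ B) B
sndF = record { tot = sndT ; fn = proj₂ ; ok = λ (a , b) → π₂-pair (enc a) (enc b) }

zeroF : ∀ {A} → Fn A nat
zeroF = record { tot = zeroT ; fn = λ _ → 0 ; ok = λ _ → refl }

sucF : Fn nat nat
sucF = record { tot = sucT ; fn = suc ; ok = λ _ → refl }

numF : ∀ {A} → ℕ → Fn A nat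
numF n = record { tot = go n ; fn = λ _ → n ; ok = λ a → go-raw n (enc a) }
  where
  go : ℕ → Total
  go zero    = zeroT
  go (suc n) = compT sucT (go n)

  go-raw : ∀ n x → raw (go n) x ≡ n
  go-raw zero    x = refl
  go-raw (suc n) x = cong suc (go-raw n x)

-- Only the type changes, not the encoding, so the underlying program is the identity; likewise for
-- `encF`.
unpairF : Fn nat (nat ⊗ nat)
unpairF = record { tot = idT ; fn = unpair ; ok = λ n → sym (pair-unpair n) }

encF : ∀ {A} → Fn A nat
encF = record { tot = idT ; fn = enc ; ok = λ _ → refl }

inj₁F : ∀ {A B} → Fn A (A ⊕ B)
inj₁F = record { tot = pairT zeroT idT ; fn = inj₁ ; ok = λ _ → refl }

inj₂F : ∀ {A B} → Fn B (A ⊕ B)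
inj₂F = record { tot = pairT (compT sucT zeroT) idT ; fn = inj₂ ; ok = λ _ → refl }

nilF : ∀ {A B} → Fn A (list B)
nilF = record { tot = zeroT ; fn = λ _ → [] ; ok = λ _ → refl }

consF : ∀ {A} → Fn (A ⊗ list A) (list A)
consF = record { tot = sucT ; fn = λ (a , as) → a ∷ as ; ok = λ _ → refl }

recur : {A B : Set} → (A → B) → (A × ℕ × B → B) → A → ℕ → B
recur f g a zero    = f a
recur f g a (suc n) = g (a , n , recur f g a n)

recF : ∀ {A B} → Fn A B → Fn (A ⊗ nat ⊗ B) B → Fn (A ⊗ nat) B
recF {A} {B} f g = record
  { tot = recT (tot f) (tot g)
  ; fn  = λ (a , n) → recur (fn f) (fn g) a n
  ; ok  = λ (a , n) → trans (recT-pair (tot f) (tot g) (enc a) n) (go a n) }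
  where
  go : ∀ a n → primRec (raw (tot f)) (raw (tot g)) (enc a) n ≡ enc (recur (fn f) (fn g) a n)
  go a zero    = ok f a
  go a (suc n) = trans (cong (λ m → raw (tot g) ⟨ enc a , ⟨ n , m ⟩ ⟩) (go a n))
                       (ok g (a , n , recur (fn f) (fn g) a n))

caseNat : ∀ {A B} → Fn A B → Fn (A ⊗ nat) B → Fn (A ⊗ nat) B
caseNat {A} {B} f g = record
  { tot = caseT (tot f) (tot g)
  ; fn  = λ (a , n) → go a n
  ; ok  = λ (a , n) → go-ok a n }
  where
  go : El A → ℕ → El B
  go a zero    = fn f a
  go a (suc n) = fn g (a , n)

  go-ok : ∀ a n → raw (caseT (tot f) (tot g)) ⟨ enc a , n ⟩ ≡ enc (go a n)
  go-ok a zero    = trans (caseT-zero (tot f) (tot g) (enc a)) (ok f a)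
  go-ok a (suc n) = trans (caseT-suc (tot f) (tot g) (enc a) n) (ok g (a , n))

caseList : ∀ {A B C} → Fn A C → Fn (A ⊗ B ⊗ list B) C → Fn (A ⊗ list B) C
caseList {A} {B} {C} f g = record
  { tot = caseT (tot f) (tot g)
  ; fn  = λ (a , bs) → go a bs
  ; ok  = λ (a , bs) → go-ok a bs }
  where
  go : El A → List (El B) → El C
  go a []       = fn f a
  go a (b ∷ bs) = fn g (a , b , bs)

  go-ok : ∀ a bs → raw (caseT (tot f) (tot g)) ⟨ enc a , encList bs ⟩ ≡ enc (go a bs)
  go-ok a []       = trans (caseT-zero (tot f) (tot g) (enc a)) (ok f a)
  go-ok a (b ∷ bs) = trans (caseT-suc (tot f) (tot g) (enc a) ⟨ enc b , encList bs ⟩) (ok g (a , b , bs))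

caseSum : ∀ {A B C D} → Fn (A ⊗ B) D → Fn (A ⊗ C) D → Fn (A ⊗ (B ⊕ C)) D
caseSum {A} {B} {C} {D} f g = record
  { tot = compT branch shuffle
  ; fn  = λ (a , s) → go a s
  ; ok  = λ (a , s) → go-ok a s }
  where
  branch shuffle : Total
  -- `shuffle` moves the tag to the last place, where `caseT` inspects it. For tag 1 the input
  -- arrives as ⟨⟨a , v⟩ , 0⟩, and `fstT` drops the leftover 0.
  branch  = caseT (tot f) (compT (tot g) fstT)
  shuffle = pairT (pairT fstT (compT sndT sndT)) (compT fstT sndT)

  shuffled : ∀ a t v → raw shuffle ⟨ a , ⟨ t , v ⟩ ⟩ ≡ ⟨ ⟨ a , v ⟩ , t ⟩
  shuffled a t v = cong₂ ⟨_,_⟩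
    (cong₂ ⟨_,_⟩ (π₁-pair a ⟨ t , v ⟩) (trans (cong π₂ (π₂-pair a ⟨ t , v ⟩)) (π₂-pair t v)))
    (trans (cong π₁ (π₂-pair a ⟨ t , v ⟩)) (π₁-pair t v))

  go : El A → El B ⊎ El C → El D
  go a (inj₁ b) = fn f (a , b)
  go a (inj₂ c) = fn g (a , c)

  go-ok : ∀ a s → raw (compT branch shuffle) ⟨ enc a , enc {B ⊕ C} s ⟩ ≡ enc (go a s)
  go-ok a (inj₁ b) = trans (cong (raw branch) (shuffled (enc a) 0 (enc b)))
    (trans (caseT-zero (tot f) (compT (tot g) fstT) ⟨ enc a , enc b ⟩) (ok f (a , b)))
  go-ok a (inj₂ c) = trans (cong (raw branch) (shuffled (enc a) 1 (enc c)))
    (trans (caseT-suc (tot f) (compT (tot g) fstT) ⟨ enc a , enc c ⟩ 0)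
      (trans (cong (raw (tot g)) (π₁-pair ⟨ enc a , enc c ⟩ 0)) (ok g (a , c))))

-- A stack machine interpreting codes

-- A frame is work pending until the current value is returned. Codes occur as their numbers, so a
-- state is purely numerical data and `step` is primitive recursive.
frame stack control state : Ty
frame   = (nat ⊗ nat) ⊕ nat ⊕ nat ⊕ (nat ⊗ nat ⊗ nat) ⊕ (nat ⊗ nat ⊗ nat)
stack   = list frame
control = (nat ⊗ nat) ⊕ nat
state   = stack ⊗ control

pattern pairFst g x   = inj₁ (g , x)
pattern pairSnd a     = inj₂ (inj₁ a)
pattern compOuter f   = inj₂ (inj₂ (inj₁ f))
pattern recStep g x n = inj₂ (inj₂ (inj₂ (inj₁ (g , x , n))))
pattern search f x n  = inj₂ (inj₂ (inj₂ (inj₂ (f , x , n))))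

pattern evaluate e x = inj₁ (e , x)
pattern return v     = inj₂ v

pushF : ∀ {A} → Fn A frame → Fn A stack → Fn A stack
pushF fr K = consF ∙ (fr ,F K)

evaluateF : ∀ {A} → Fn A stack → Fn A nat → Fn A nat → Fn A state
evaluateF K e x = K ,F inj₁F ∙ (e ,F x)

returnF : ∀ {A} → Fn A stack → Fn A nat → Fn A state
returnF K v = K ,F inj₂F ∙ v

npairF : ∀ {A} → Fn A nat → Fn A nat → Fn A nat
npairF f g = encF ∙ (f ,F g)

π₁F π₂F : Fn nat nat
π₁F = fstF ∙ unpairF
π₂F = sndF ∙ unpairF

module Evaluation where

  K : Fn (stack ⊗ nat ⊗ nat) stack
  K = fstF

  e x r r₁ r₂ : Fn (stack ⊗ nat ⊗ nat) nat
  e  = fstF ∙ sndF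
  x  = sndF ∙ sndF
  r  = π₂F ∙ e
  r₁ = π₁F ∙ r
  r₂ = π₂F ∙ r

  -- The number is `π₂ x`, the recursion argument. At a successor the same code number `e` is
  -- evaluated again at the predecessor, with the step function pending.
  recurse : Fn ((stack ⊗ nat ⊗ nat) ⊗ nat) state
  recurse = caseNat (evaluateF K r₁ (π₁F ∙ x))
    (evaluateF (pushF (inj₂F ∙ inj₂F ∙ inj₂F ∙ inj₁F ∙
                       (r₂ ∙ fstF ,F π₁F ∙ x ∙ fstF ,F sndF)) (K ∙ fstF))
               (e ∙ fstF) (npairF (π₁F ∙ x ∙ fstF) sndF))

  -- The number is the tag of `e`. Each `caseNat` takes one off it, so the branches follow the tags
  -- 0 to 8; the last one catches all larger tags, which decode to `cZero`.
  dispatch : Fn ((stack ⊗ nat ⊗ nat) ⊗ nat) state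
  dispatch =
    caseNat (returnF K zeroF)
    (caseNat (returnF K (sucF ∙ x))
    (caseNat (returnF K x)
    (caseNat (returnF K (π₁F ∙ x))
    (caseNat (returnF K (π₂F ∙ x))
    (caseNat (evaluateF (pushF (inj₁F ∙ (r₂ ,F x)) K) r₁ x)
    (caseNat (evaluateF (pushF (inj₂F ∙ inj₂F ∙ inj₁F ∙ r₁) K) r₂ x)
    (caseNat (recurse ∙ (idF ,F π₂F ∙ x))
    (caseNat (evaluateF (pushF (inj₂F ∙ inj₂F ∙ inj₂F ∙ inj₂F ∙ (r ,F x ,F zeroF)) K)
                        r (npairF x zeroF))
    (returnF K zeroF ∙ fstF)))))))))

open Evaluation using (recurse; dispatch)

resume : Fn (nat ⊗ frame ⊗ stack) state
resume =
  caseSum (evaluateF (pushF (inj₂F ∙ inj₁F ∙ v) K) (fstF ∙ d) (sndF ∙ d))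
  (caseSum (returnF K (npairF d v))
  (caseSum (evaluateF K d v)
  (caseSum (evaluateF K (fstF ∙ d)
             (npairF (fstF ∙ sndF ∙ d) (npairF (sndF ∙ sndF ∙ d) v)))
  -- A test value 0 ends the search with the current index; any other value restarts it at the next
  -- index.
  (caseNat (returnF K (sndF ∙ sndF ∙ d))
    (evaluateF (pushF (inj₂F ∙ inj₂F ∙ inj₂F ∙ inj₂F ∙
                       (fstF ∙ d ,F fstF ∙ sndF ∙ d ,F sucF ∙ sndF ∙ sndF ∙ d) ∙ fstF)
                      (K ∙ fstF))
               (fstF ∙ d ∙ fstF)
               (npairF (fstF ∙ sndF ∙ d) (sucF ∙ sndF ∙ sndF ∙ d) ∙ fstF))
   ∙ (idF ,F v)))))
  ∙ ((fstF ,F sndF ∙ sndF) ,F fstF ∙ sndF)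
  where
  v : ∀ {A} → Fn ((nat ⊗ stack) ⊗ A) nat
  v = fstF ∙ fstF
  K : ∀ {A} → Fn ((nat ⊗ stack) ⊗ A) stack
  K = sndF ∙ fstF
  d : ∀ {A} → Fn ((nat ⊗ stack) ⊗ A) A
  d = sndF

step : Fn state state
step = caseSum
  (dispatch ∙ (idF ,F π₁F ∙ fstF ∙ sndF))
  -- A value on the empty stack is a final state and is mapped to itself, so running longer does not
  -- change the outcome.
  (caseList (returnF nilF idF) resume ∙ (sndF ,F fstF))

run : Fn (state ⊗ nat) state
run = recF idF (step ∙ sndF ∙ sndF)

after : ℕ → El state → El state
after n s = fn run (s , n)

halted : Fn state nat
halted = caseSum (numF 1) (caseList zeroF (numF 1) ∙ (sndF ,F fstF))

-- The search for a zero of f ⟨ x , _ ⟩ yields r, given that the test at n has returned v.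
data SearchYields (f : Code) (x : ℕ) : ℕ → ℕ → ℕ → Set where
  found : ∀ {n} → SearchYields f x n 0 n
  next  : ∀ {n k v r} → Eval f ⟨ x , suc n ⟩ v → SearchYields f x (suc n) v r →
          SearchYields f x n (suc k) r

-- A machine state denotes successful completion of all pending work. Being pulled back along step,
-- this yields soundness of the machine without counting steps.
StackOk : ℕ → List (El frame) → Set
StackOk v []                  = ⊤
StackOk v (pairFst g x   ∷ K) = ∃ λ b → Eval (decode g) x b × StackOk ⟨ v , b ⟩ K
StackOk v (pairSnd a     ∷ K) = StackOk ⟨ a , v ⟩ K
StackOk v (compOuter f   ∷ K) = ∃ λ b → Eval (decode f) v b × StackOk b K
StackOk v (recStep g x n ∷ K) = ∃ λ b → Eval (decode g) ⟨ x , ⟨ n , v ⟩ ⟩ b × StackOk b K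
StackOk v (search f x n  ∷ K) = ∃ λ r → SearchYields (decode f) x n v r × StackOk r K

Ok : El state → Set
Ok (K , evaluate e x) = ∃ λ v → Eval (decode e) x v × StackOk v K
Ok (K , return v)     = StackOk v K

-- Collects the positive tests while the search advances; at its end they form the second premise of
-- `eMu`.
search⇒mu : ∀ {f x n v r} → SearchYields f x n v r → Eval f ⟨ x , n ⟩ v →
            (∀ m → m < n → ∃ λ k → Eval f ⟨ x , m ⟩ (suc k)) → Eval (cMu f) x r
search⇒mu found       ev below = eMu ev below
search⇒mu {f} {x} {n} (next {k = k} ev' rest) ev below = search⇒mu rest ev' λ m m<1+n →
  case m≤n⇒m<n∨m≡n (≤-pred m<1+n) of λ where
    (inj₁ m<n) → below m m<n
    (inj₂ m≡n) → subst (λ i → ∃ λ k → Eval f ⟨ x , i ⟩ (suc k)) (sym m≡n) (k , ev)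

recurse-ok : ∀ K e x n → decode e ≡ expand decode 7 (π₂ e) → π₂ x ≡ n →
             Ok (fn recurse ((K , e , x) , n)) → Ok (K , evaluate e x)
recurse-ok K e x zero eq n-eq (v , ev , s) = v ,
  subst₂ (λ c y → Eval c y v) (sym eq) (trans (cong ⟨ π₁ x ,_⟩ (sym n-eq)) (pair-unpair x))
    (eRec0 {x = π₁ x} ev) , s
recurse-ok K e x (suc n) eq n-eq (a , eva , b , evb , s) = b ,
  subst₂ (λ c y → Eval c y b) (sym eq) (trans (cong ⟨ π₁ x ,_⟩ (sym n-eq)) (pair-unpair x))
    (eRecS {x = π₁ x} {n = n} (subst (λ c → Eval c ⟨ π₁ x , n ⟩ a) eq eva) evb) , s

dispatch-ok : ∀ K e x t → decode e ≡ expand decode t (π₂ e) →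
              Ok (fn dispatch ((K , e , x) , t)) → Ok (K , evaluate e x)
dispatch-ok K e x 0 eq s = 0 , subst (λ c → Eval c x 0) (sym eq) eZero , s
dispatch-ok K e x 1 eq s = suc x , subst (λ c → Eval c x (suc x)) (sym eq) eSucc , s
dispatch-ok K e x 2 eq s = x , subst (λ c → Eval c x x) (sym eq) eId , s
dispatch-ok K e x 3 eq s = π₁ x , subst (λ c → Eval c x (π₁ x)) (sym eq) eFst , s
dispatch-ok K e x 4 eq s = π₂ x , subst (λ c → Eval c x (π₂ x)) (sym eq) eSnd , s
dispatch-ok K e x 5 eq (a , eva , b , evb , s) =
  ⟨ a , b ⟩ , subst (λ c → Eval c x ⟨ a , b ⟩) (sym eq) (ePair eva evb) , s
dispatch-ok K e x 6 eq (a , eva , b , evb , s) =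
  b , subst (λ c → Eval c x b) (sym eq) (eComp eva evb) , s
dispatch-ok K e x 7 eq s = recurse-ok K e x (π₂ x) eq refl s
dispatch-ok K e x 8 eq (v , ev , r , yields , s) =
  r , subst (λ c → Eval c x r) (sym eq) (search⇒mu yields ev λ _ ()) , s
dispatch-ok K e x (suc (suc (suc (suc (suc (suc (suc (suc (suc t))))))))) eq s =
  0 , subst (λ c → Eval c x 0) (sym eq) eZero , s

resume-ok : ∀ v fr K → Ok (fn resume (v , fr , K)) → StackOk v (fr ∷ K)
resume-ok v (pairFst g x)   K s = s
resume-ok v (pairSnd a)     K s = s
resume-ok v (compOuter f)   K s = s
resume-ok v (recStep g x n) K s = s
resume-ok zero    (search f x n) K s = n , found , s
resume-ok (suc v) (search f x n) K (w , ev , r , yields , s) = r , next ev yields , s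

step-ok : ∀ s → Ok (fn step s) → Ok s
step-ok (K      , evaluate e x) s = dispatch-ok K e x (π₁ e) (decode-expand e) s
step-ok ([]     , return v)     s = tt
step-ok (fr ∷ K , return v)     s = resume-ok v fr K s

after-ok : ∀ n s → Ok (after n s) → Ok s
after-ok zero    s o = o
after-ok (suc n) s o = after-ok n s (step-ok (after n s) o)

after-+ : ∀ m n s → after m (after n s) ≡ after (m + n) s
after-+ zero    n s = refl
after-+ (suc m) n s = cong (fn step) (after-+ m n s)

-- Leaving the number of steps implicit lets runs be composed without arithmetic; `reaches⇒after`
-- recovers it.
data Reaches : El state → El state → Set where
  done : ∀ {s} → Reaches s s
  move : ∀ s {s'} → Reaches (fn step s) s' → Reaches s s'

reaches-trans : ∀ {s s' s''} → Reaches s s' → Reaches s' s'' → Reaches s s''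
reaches-trans done       q = q
reaches-trans (move s p) q = move s (reaches-trans p q)

reaches⇒after : ∀ {s s'} → Reaches s s' → ∃ λ n → after n s ≡ s'
reaches⇒after done       = 0 , refl
reaches⇒after (move s p) =
  let n , eq = reaches⇒after p in n + 1 , trans (sym (after-+ n 1 s)) eq

dispatch-reaches : ∀ {K e x t s} → π₁ e ≡ t →
                   Reaches (fn dispatch ((K , e , x) , t)) s → Reaches (K , evaluate e x) s
dispatch-reaches {K} {e} {x} refl = move (K , evaluate e x)

-- Induction on `d`, the number of positive tests remaining before the zero at `n`.
search-reaches : ∀ {f x n K} d i → d + i ≡ n →
  (∀ m → m < n → ∃ λ k → ∀ K → Reaches (K , evaluate f ⟨ x , m ⟩) (K , return (suc k))) →
  (∀ K → Reaches (K , evaluate f ⟨ x , n ⟩) (K , return 0)) →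
  Reaches (search f x i ∷ K , evaluate f ⟨ x , i ⟩) (K , return n)
search-reaches {f} {x} {n} {K} zero i refl below at =
  reaches-trans (at (search f x i ∷ K)) (move (search f x i ∷ K , return 0) done)
search-reaches {f} {x} {n} {K} (suc d) i eq below at with below i (subst (suc i ≤_) eq (s≤s (m≤n+m i d)))
... | k , reach = reaches-trans (reach (search f x i ∷ K))
  (move (search f x i ∷ K , return (suc k))
    (search-reaches d (suc i) (trans (+-suc d i) eq) below at))

-- The stack is arbitrary so that a subcomputation can run on top of pending frames. The recursion
-- is on the evaluation derivation.
reaches-value : ∀ {c x y} → Eval c x y → ∀ e → decode e ≡ c → ∀ K →
                Reaches (K , evaluate e x) (K , return y)
-- With the tag as a separate argument, a literal tag reduces `expand` to a constructor, and
-- matching then selects the evaluation rule.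
dispatch-value : ∀ t {c x y} e → π₁ e ≡ t → c ≡ expand decode t (π₂ e) → Eval c x y → ∀ K →
                 Reaches (K , evaluate e x) (K , return y)

reaches-value ev e eq = dispatch-value (π₁ e) e refl (trans (sym eq) (decode-expand e)) ev

dispatch-value 0 e t-eq refl eZero K = dispatch-reaches t-eq done
dispatch-value 1 e t-eq refl eSucc K = dispatch-reaches t-eq done
dispatch-value 2 e t-eq refl eId K = dispatch-reaches t-eq done
dispatch-value 3 e t-eq refl eFst K = dispatch-reaches t-eq done
dispatch-value 4 e t-eq refl eSnd K = dispatch-reaches t-eq done
dispatch-value 5 {x = x} e t-eq refl (ePair {a = a} {b = b} evf evg) K = dispatch-reaches t-eq
  (reaches-trans (reaches-value evf f refl (pairFst g x ∷ K))
  (move (pairFst g x ∷ K , return a)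
  (reaches-trans (reaches-value evg g refl (pairSnd a ∷ K))
  (move (pairSnd a ∷ K , return b) done))))
  where f = π₁ (π₂ e) ; g = π₂ (π₂ e)
dispatch-value 6 e t-eq refl (eComp {a = a} evg evf) K = dispatch-reaches t-eq
  (reaches-trans (reaches-value evg g refl (compOuter f ∷ K))
  (move (compOuter f ∷ K , return a) (reaches-value evf f refl K)))
  where f = π₁ (π₂ e) ; g = π₂ (π₂ e)
dispatch-value 7 e t-eq refl (eRec0 {x = x} evf) K = dispatch-reaches t-eq
  (subst (λ s → Reaches s _) (sym start) (reaches-value evf (π₁ (π₂ e)) refl K))
  where
  start : fn recurse ((K , e , ⟨ x , 0 ⟩) , π₂ ⟨ x , 0 ⟩) ≡ (K , evaluate (π₁ (π₂ e)) x)
  start = trans (cong (λ n → fn recurse ((K , e , ⟨ x , 0 ⟩) , n)) (π₂-pair x 0))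
                (cong (λ y → K , evaluate (π₁ (π₂ e)) y) (π₁-pair x 0))
dispatch-value 7 e t-eq refl (eRecS {x = x} {n = n} {a = a} eva evg) K = dispatch-reaches t-eq
  (subst (λ s → Reaches s _) (sym start)
  (reaches-trans (dispatch-value 7 e t-eq refl eva (recStep g x n ∷ K))
  (move (recStep g x n ∷ K , return a) (reaches-value evg g refl K))))
  where
  g = π₂ (π₂ e)
  start : fn recurse ((K , e , ⟨ x , suc n ⟩) , π₂ ⟨ x , suc n ⟩) ≡
          (recStep g x n ∷ K , evaluate e ⟨ x , n ⟩)
  start = trans (cong (λ m → fn recurse ((K , e , ⟨ x , suc n ⟩) , m)) (π₂-pair x (suc n)))
                (cong (λ y → recStep g y n ∷ K , evaluate e ⟨ y , n ⟩) (π₁-pair x (suc n)))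
dispatch-value 8 {x = x} e t-eq refl (eMu {n = n} at below) K = dispatch-reaches t-eq
  (search-reaches n 0 (+-identityʳ n)
    (λ m m<n → proj₁ (below m m<n) , reaches-value (proj₂ (below m m<n)) (π₂ e) refl)
    (reaches-value at (π₂ e) refl))
dispatch-value (suc (suc (suc (suc (suc (suc (suc (suc (suc t))))))))) e t-eq refl eZero K =
  dispatch-reaches t-eq done

after-final : ∀ n v → after n ([] , return v) ≡ ([] , return v)
after-final zero    v = refl
after-final (suc n) v = cong (fn step) (after-final n v)

return-injective : ∀ {K K' v v'} → _≡_ {A = El state} (K , return v) (K' , return v') → v ≡ v'
return-injective refl = refl

-- Final states are fixed by `step`, so both runs can be prolonged to `m + n` steps and compared
-- there.
after-final-unique : ∀ n m s {v v'} →
  after n s ≡ ([] , return v) → after m s ≡ ([] , return v') → v ≡ v'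
after-final-unique n m s {v} {v'} p q = return-injective (begin
  ([] , return v)         ≡⟨ after-final m v ⟨
  after m ([] , return v) ≡⟨ cong (after m) p ⟨
  after m (after n s)     ≡⟨ after-+ m n s ⟩
  after (m + n) s         ≡⟨ cong (λ k → after k s) (+-comm m n) ⟩
  after (n + m) s         ≡⟨ after-+ n m s ⟨
  after n (after m s)     ≡⟨ cong (after n) q ⟩
  after n ([] , return v') ≡⟨ after-final n v' ⟩
  ([] , return v')        ∎)
  where open ≡-Reasoning

-- Determinism is inherited from the machine: both derivations give halting runs from the same
-- initial state.
Eval-functional : ∀ {c x y y'} → Eval c x y → Eval c x y' → y ≡ y'
Eval-functional {c} {x} ev ev' =
  let e , eq = decode-surjective c
      n , p  = reaches⇒after (reaches-value ev e eq [])
      m , q  = reaches⇒after (reaches-value ev' e eq [])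
  in after-final-unique n m ([] , evaluate e x) p q

HaltsWithin : ℕ → ℕ → ℕ → Set
HaltsWithin s e x = fn halted (after s ([] , evaluate e x)) ≡ 0

halted-step : ∀ s → fn halted s ≡ 0 → fn step s ≡ s
halted-step ([] , return v) h = refl

haltsWithin-mono : ∀ {s s' e x} → s ≤ s' → HaltsWithin s e x → HaltsWithin s' e x
haltsWithin-mono {s} {s'} {e} {x} s≤s' h =
  subst (λ n → HaltsWithin n e x) (m∸n+n≡m s≤s') (go (s' ∸ s))
  where
  go : ∀ d → HaltsWithin (d + s) e x
  go zero    = h
  go (suc d) = subst (λ st → fn halted st ≡ 0)
    (sym (halted-step (after (d + s) ([] , evaluate e x)) (go d))) (go d)

halted-ok : ∀ s → fn halted s ≡ 0 → Ok s
halted-ok ([] , return v) h = tt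

-- In one direction the machine simulates the derivation; in the other, `Ok` holds of a halted state
-- and is pulled back to the start.
halts⇔ : ∀ e x → (∃ λ y → φStd e x y) ⇔ (∃ λ s → HaltsWithin s e x)
halts⇔ e x = mk⇔
  (λ (y , ev) → let n , p = reaches⇒after (reaches-value ev e refl []) in n , cong (fn halted) p)
  (λ (s , h) →
    let y , ev , _ = after-ok s ([] , evaluate e x) (halted-ok (after s ([] , evaluate e x)) h)
    in y , ev)

-- Decidable predicates and the s-m-n function

-- The value 0 stands for truth, as in `RecursiveSet`.
record Decider {A : Ty} (P : El A → Set) : Set where
  field
    test : Fn A nat
    dec  : ∀ a → P a ⇔ (fn test a ≡ 0)

open Decider

pullback : ∀ {A B} {P : El B → Set} (f : Fn A B) → Decider P → Decider (λ a → P (fn f a))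
pullback f P? = record { test = test P? ∙ f ; dec = λ a → dec P? (fn f a) }

equivalent : ∀ {A} {P Q : El A → Set} → (∀ a → Q a ⇔ P a) → Decider P → Decider Q
equivalent Q⇔P P? = record { test = test P? ; dec = λ a → ⇔-trans (Q⇔P a) (dec P? a) }

isZero : Decider {nat} (λ n → n ≡ 0)
isZero = record { test = idF ; dec = λ _ → ⇔-refl }

ifF : ∀ {A B} → Fn A nat → Fn A B → Fn A B → Fn A B
ifF c t f = caseNat t (f ∙ fstF) ∙ (idF ,F c)

infixr 6 _∧D_
infixr 5 _∨D_
_∧D_ : ∀ {A} {P Q : El A → Set} → Decider P → Decider Q → Decider (λ a → P a × Q a)
_∧D_ {A} {P} {Q} P? Q? = record { test = both ; dec = go }
  where
  both : Fn A nat
  both = ifF (test P?) (test Q?) (numF 1)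
  go : ∀ a → (P a × Q a) ⇔ (fn both a ≡ 0)
  go a with fn (test P?) a | dec P? a
  ... | zero  | p = mk⇔ (λ (_ , q) → to (dec Q? a) q) (λ eq → from p refl , from (dec Q? a) eq)
  ... | suc _ | p = mk⇔ (λ (x , _) → contradiction (to p x) λ ()) λ ()

¬D_ : ∀ {A} {P : El A → Set} → Decider P → Decider (λ a → ¬ P a)
¬D_ {A} {P} P? = record { test = neg ; dec = go }
  where
  neg : Fn A nat
  neg = ifF (test P?) (numF 1) zeroF
  go : ∀ a → (¬ P a) ⇔ (fn neg a ≡ 0)
  go a with fn (test P?) a | dec P? a
  ... | zero  | p = mk⇔ (λ ¬x → contradiction (from p refl) ¬x) λ ()
  ... | suc _ | p = mk⇔ (λ _ → refl) (λ _ x → contradiction (to p x) λ ())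

_∨D_ : ∀ {A} {P Q : El A → Set} → Decider P → Decider Q → Decider (λ a → P a ⊎ Q a)
_∨D_ {A} {P} {Q} P? Q? = record { test = either ; dec = go }
  where
  either : Fn A nat
  either = ifF (test P?) zeroF (test Q?)
  go : ∀ a → (P a ⊎ Q a) ⇔ (fn either a ≡ 0)
  go a with fn (test P?) a | dec P? a
  ... | zero  | p = mk⇔ (λ _ → refl) (λ _ → inj₁ (from p refl))
  ... | suc _ | p = mk⇔
    [ (λ x → contradiction (to p x) λ ()) , to (dec Q? a) ]′ (λ eq → inj₂ (from (dec Q? a) eq))

anyBelow : ∀ {A} {P : El A × ℕ → Set} → Decider {A ⊗ nat} P →
           Decider {A ⊗ nat} (λ (a , n) → ∃ λ k → k < n × P (a , k))
anyBelow {A} {P} P? = record { test = scan ; dec = λ (a , n) → go a n }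
  where
  scan : Fn (A ⊗ nat) nat
  scan = recF (numF 1) (ifF (test P? ∙ (fstF ,F fstF ∙ sndF)) zeroF (sndF ∙ sndF))
  go : ∀ a n → (∃ λ k → k < n × P (a , k)) ⇔ (fn scan (a , n) ≡ 0)
  go a zero = mk⇔ (λ ()) λ ()
  go a (suc n) with fn (test P?) (a , n) | dec P? (a , n)
  ... | zero  | p = mk⇔ (λ _ → refl) (λ _ → n , ≤-refl , from p refl)
  ... | suc _ | p = mk⇔
    (λ (k , k<1+n , x) → case m≤n⇒m<n∨m≡n (≤-pred k<1+n) of λ where
      (inj₁ k<n)  → to (go a n) (k , k<n , x)
      (inj₂ refl) → contradiction (to p x) λ ())
    (λ eq → let k , k<n , x = from (go a n) eq in k , m<n⇒m<1+n k<n , x)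

-- Obtained from bounded existence by two negations; decidability makes the inner one removable
-- without excluded middle.
allBelow : ∀ {A} {P : El A × ℕ → Set} → Decider {A ⊗ nat} P →
           Decider {A ⊗ nat} (λ (a , n) → ∀ k → k < n → P (a , k))
allBelow {A} {P} P? = equivalent equiv (¬D anyBelow (¬D P?))
  where
  stable : ∀ a → ¬ ¬ P a → P a
  stable a ¬¬p with fn (test P?) a | dec P? a
  ... | zero  | p = from p refl
  ... | suc _ | p = contradiction (λ x → contradiction (to p x) λ ()) ¬¬p
  equiv : ∀ ((a , n) : El A × ℕ) → (∀ k → k < n → P (a , k)) ⇔ (¬ ∃ λ k → k < n × ¬ P (a , k))
  equiv (a , n) = mk⇔ (λ all (k , k<n , ¬p) → ¬p (all k k<n))
                      (λ none k k<n → stable (a , k) λ ¬p → none (k , k<n , ¬p))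

-- Swaps the function computed for a pointwise equal one, so that later statements mention the
-- familiar operation and not its recursive definition.
withFn : ∀ {A B} (f : Fn A B) (g : El A → El B) → (∀ a → fn f a ≡ g a) → Fn A B
withFn f g f≗g = record { tot = tot f ; fn = g ; ok = λ a → trans (ok f a) (cong enc (f≗g a)) }

monusF : Fn (nat ⊗ nat) nat
monusF = withFn byPredecessors (λ (m , n) → m ∸ n) (λ (m , n) → go m n)
  where
  predF : Fn nat nat
  predF = withFn (caseNat zeroF sndF ∙ (idF ,F idF)) pred λ { zero → refl ; (suc n) → refl }
  byPredecessors : Fn (nat ⊗ nat) nat
  byPredecessors = recF idF (predF ∙ sndF ∙ sndF)
  go : ∀ m n → fn byPredecessors (m , n) ≡ m ∸ n
  go m zero    = refl
  go m (suc n) = trans (cong pred (go m n)) (pred[m∸n]≡m∸[1+n] m n)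

≤D : Decider {nat ⊗ nat} (λ (m , n) → m ≤ n)
≤D = equivalent (λ (m , n) → mk⇔ m≤n⇒m∸n≡0 m∸n≡0⇒m≤n) (pullback monusF isZero)

fn-recursive : (f : Fn nat nat) → Recursive (fn f)
fn-recursive f with decode-surjective (code (tot f))
... | c , eq = c , λ x → subst₂ (λ c y → Eval c x y) (sym eq) (ok f x) (runs (tot f) x)

recursiveF : ∀ {A} (f : ℕ → ℕ) → Recursive f → Fn A nat
recursiveF f (c , evals) = record
  { tot = record { raw = f ; code = decode c ; runs = evals } ; fn = λ a → f (enc a) ; ok = λ _ → refl }

module _ {A : Ty} {P : El A × ℕ → Set} (P? : Decider {A ⊗ nat} P) where

  searchCode : Code
  searchCode = cMu (code (tot (test P?)))

  private
    test-value : ∀ a n {y} → Eval (code (tot (test P?))) ⟨ enc a , n ⟩ y → y ≡ fn (test P?) (a , n)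
    test-value a n ev =
      trans (Eval-functional ev (runs (tot (test P?)) ⟨ enc a , n ⟩)) (ok (test P?) (a , n))

    test-runs : ∀ a n → Eval (code (tot (test P?))) ⟨ enc a , n ⟩ (fn (test P?) (a , n))
    test-runs a n =
      subst (Eval _ ⟨ enc a , n ⟩) (ok (test P?) (a , n)) (runs (tot (test P?)) ⟨ enc a , n ⟩)

    -- `cMu` stops at the least zero and demands explicit positive values before it, so an arbitrary
    -- zero must be replaced by the first.
    first-zero : ∀ (f : ℕ → ℕ) n → f n ≡ 0 → ∃ λ m → f m ≡ 0 × (∀ i → i < m → ∃ λ k → f i ≡ suc k)
    first-zero f zero    eq = 0 , eq , λ _ ()
    first-zero f (suc n) eq with f 0 in eq₀
    ... | zero  = 0 , eq₀ , λ _ ()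
    ... | suc k with first-zero (f ∘ suc) n eq
    ...   | m , eq' , below = suc m , eq' , λ { zero _ → k , eq₀ ; (suc i) (s≤s i<m) → below i i<m }

  searchCode-halts⇔ : ∀ a → (∃ λ y → Eval searchCode (enc a) y) ⇔ (∃ λ n → P (a , n))
  searchCode-halts⇔ a = mk⇔
    (λ { (n , eMu at _) → n , from (dec P? (a , n)) (sym (test-value a n at)) })
    (λ (n , p) →
      let m , eq , below = first-zero (λ i → fn (test P?) (a , i)) n (to (dec P? (a , n)) p)
      in m , eMu (subst (Eval _ ⟨ enc a , m ⟩) eq (test-runs a m))
           (λ i i<m → let k , eqi = below i i<m in k , subst (Eval _ ⟨ enc a , i ⟩) eqi (test-runs a i)))

-- Defined directly on numbers because the s-m-n function has to compute it. The number 0 decodes to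
-- `cZero`, and each layer composes with `cSucc`.
constCode : ℕ → ℕ
constCode zero    = 0
constCode (suc n) = ⟨ 6 , ⟨ ⟨ 1 , 0 ⟩ , constCode n ⟩ ⟩

constCode-eval : ∀ n x → Eval (decode (constCode n)) x n
constCode-eval zero    x = eZero
constCode-eval (suc n) x = subst (λ c → Eval c x (suc n)) (sym (decode-comp ⟨ 1 , 0 ⟩ (constCode n)))
  (eComp (constCode-eval n x) eSucc)

constCodeF : Fn nat nat
constCodeF = withFn
  (recF zeroF (npairF (numF 6) (npairF (npairF (numF 1) zeroF) (sndF ∙ sndF))) ∙ (idF ,F idF))
  constCode λ n → go n n
  where
  go : ∀ m n → recur (λ _ → 0) (λ (_ , _ , c) → ⟨ 6 , ⟨ ⟨ 1 , 0 ⟩ , c ⟩ ⟩) m n ≡ constCode n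
  go m zero    = refl
  go m (suc n) = cong (λ c → ⟨ 6 , ⟨ ⟨ 1 , 0 ⟩ , c ⟩ ⟩) (go m n)

-- Tags 6, 5 and 2 stand for `cComp`, `cPair` and `cId`: the input `i` is paired with the constant
-- `x` before `q` runs.
smn : ℕ → ℕ → ℕ
smn q x = ⟨ 6 , ⟨ q , ⟨ 5 , ⟨ constCode x , ⟨ 2 , 0 ⟩ ⟩ ⟩ ⟩ ⟩

smnF : ℕ → Fn nat nat
smnF q = npairF (numF 6) (npairF (numF q) (npairF (numF 5) (npairF constCodeF (npairF (numF 2) zeroF))))

smn-eval⇔ : ∀ q x i y → φStd (smn q x) i y ⇔ φStd q ⟨ x , i ⟩ y
smn-eval⇔ q x i y = mk⇔
  (λ ev → forward (subst (λ c → Eval c i y) decode-smn ev))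
  (λ ev → subst (λ c → Eval c i y) (sym decode-smn) (eComp (ePair (constCode-eval x i) eId) ev))
  where
  decode-smn : decode (smn q x) ≡ cComp (decode q) (cPair (decode (constCode x)) cId)
  decode-smn = trans (decode-comp q ⟨ 5 , ⟨ constCode x , ⟨ 2 , 0 ⟩ ⟩ ⟩)
    (cong (cComp (decode q)) (trans (decode-pair (constCode x) ⟨ 2 , 0 ⟩)
      (cong (cPair (decode (constCode x))) (decode-tag 2 0))))
  forward : Eval (cComp (decode q) (cPair (decode (constCode x)) cId)) i y → Eval (decode q) ⟨ x , i ⟩ y
  forward (eComp (ePair {a = a} eva eId) ev) =
    subst (λ a → Eval (decode q) ⟨ a , i ⟩ y) (Eval-functional eva (constCode-eval x i)) ev

-- Finite families of languages

Agree : ℕ → (ℕ → Set) → (ℕ → Set) → Set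
Agree n A B = ∀ x → x < n → A x ⇔ B x

Separates : ℕ → (ℕ → ℕ → Set) → Set
Separates n 𝓛 = ∀ j j' → Agree n (𝓛 j) (𝓛 j') → SameSet (𝓛 j) (𝓛 j')

separates-⇔ : ∀ {n 𝓛 𝓜} → (∀ j x → 𝓛 j x ⇔ 𝓜 j x) → Separates n 𝓛 ⇔ Separates n 𝓜
separates-⇔ {n} 𝓛⇔𝓜 = mk⇔ (transfer 𝓛⇔𝓜) (transfer λ j x → ⇔-sym (𝓛⇔𝓜 j x))
  where
  transfer : ∀ {𝓛 𝓜} → (∀ j x → 𝓛 j x ⇔ 𝓜 j x) → Separates n 𝓛 → Separates n 𝓜
  transfer e sep j j' agree x = ⇔-trans (⇔-sym (e j x)) (⇔-trans
    (sep j j' (λ y y<n → ⇔-trans (e j y) (⇔-trans (agree y y<n) (⇔-sym (e j' y)))) x) (e j' x))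

∃-⇔ : ∀ {P Q : ℕ → Set} → (∀ n → P n ⇔ Q n) → ∃ P ⇔ ∃ Q
∃-⇔ e = mk⇔ (λ (n , p) → n , to (e n) p) (λ (n , q) → n , from (e n) q)

∀-⇔ : ∀ {P Q : ℕ → Set} → (∀ n → P n ⇔ Q n) → (∀ n → P n) ⇔ (∀ n → Q n)
∀-⇔ e = mk⇔ (λ p n → to (e n) (p n)) (λ q n → from (e n) (q n))

stable : ExcludedMiddle 0ℓ → ∀ {P : Set} → ¬ ¬ P → P
stable em {P} ¬¬p with em {P}
... | yes p = p
... | no ¬p = contradiction ¬p ¬¬p

members-bounded : ∀ S → ∃ λ n → ∀ x → x ∈ S → x < n
members-bounded []      = 0 , λ _ ()
members-bounded (y ∷ S) with members-bounded S
... | n , below = suc y ⊔ n , λ where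
  x (here refl) → m≤m⊔n (suc y) n
  x (there x∈S) → ≤-trans (below x x∈S) (m≤n⊔m (suc y) n)

module Compactness (em : ExcludedMiddle 0ℓ) (𝓛 : ℕ → ℕ → Set) where

  -- Plays the role of "infinitely many nodes above" in König's lemma: among the indices in `P`, no
  -- finite restriction determines the language.
  Unseparated : (ℕ → Set) → Set
  Unseparated P = ∀ m → ∃ λ j → ∃ λ j' →
    P j × P j' × Agree m (𝓛 j) (𝓛 j') × ¬ SameSet (𝓛 j) (𝓛 j')

  -- The branch of König's lemma, where membership is tried before non-membership.
  Follows : ℕ → ℕ → Set
  Branch  : ℕ → Set
  Follows zero    j = ⊤
  Follows (suc n) j = Follows n j × (Branch n ⇔ 𝓛 j n)
  Branch n = Unseparated λ j → Follows n j × 𝓛 j n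

  follows-agree : ∀ {n j} → Follows n j → Agree n Branch (𝓛 j)
  follows-agree {suc n} (f , e) x x<1+n with m≤n⇒m<n∨m≡n (≤-pred x<1+n)
  ... | inj₁ x<n  = follows-agree f x x<n
  ... | inj₂ refl = e

  agree-mono : ∀ {m n A B} → m ≤ n → Agree n A B → Agree m A B
  agree-mono m≤n agree x x<m = agree x (≤-trans x<m m≤n)

  -- If the half of the family containing `n` is separated at some bound, then pairs agreeing beyond
  -- that bound and beyond `n` must lie in the other half.
  follows-unseparated : Unseparated (Follows 0) → ∀ n → Unseparated (Follows n)
  follows-unseparated h zero    = h
  follows-unseparated h (suc n) m with em {Branch n}
  ... | yes b = let j , j' , (f , l) , (f' , l') , rest = b m in
    j , j' , (f , mk⇔ (λ _ → l) (λ _ → b)) , (f' , mk⇔ (λ _ → l') (λ _ → b)) , rest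
  -- If there were no pair for `m` among the languages omitting `n`, every bound `m'` would get a
  -- pair containing `n`, against `¬b`. Agreement up to `suc n` puts both members of a pair in the
  -- same half.
  ... | no ¬b = stable em λ none → ¬b λ m' →
    let k = m ⊔ (m' ⊔ suc n)
        j , j' , f , f' , agree , differ = follows-unseparated h n k
        at-n = agree n (≤-trans (m≤n⊔m m' (suc n)) (m≤n⊔m m (m' ⊔ suc n)))
    in case em {𝓛 j n} of λ where
      (yes l) → j , j' , (f , l) , (f' , to at-n l)
                , agree-mono (≤-trans (m≤m⊔n m' (suc n)) (m≤n⊔m m (m' ⊔ suc n))) agree , differ
      (no ¬l) → contradiction
        (j , j' , (f  , mk⇔ (λ b → contradiction b ¬b) (λ l → contradiction l ¬l))
                , (f' , mk⇔ (λ b → contradiction b ¬b) (λ l → contradiction (from at-n l) ¬l))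
                , agree-mono (m≤m⊔n m (m' ⊔ suc n)) agree , differ) none

  -- A finite set specifying for `Branch` lies below some `n`, but two distinct members follow
  -- `Branch` up to `n`.
  xtdFinite⇒separates : XTDFinite 𝓛 → ∃ λ n → Separates n 𝓛
  xtdFinite⇒separates (d , specify) = stable em λ none →
    let unseparated = follows-unseparated λ m → stable em λ no-pair → none
          (m , λ j j' agree → stable em λ differ → no-pair (j , j' , tt , tt , agree , differ))
        S , _ , specifying = specify Branch
        n , bound = members-bounded S
        j , j' , f , f' , _ , differ = unseparated n 0
    in differ (specifying j j' (λ x x∈S → follows-agree f x (bound x x∈S))
                               (λ x x∈S → follows-agree f' x (bound x x∈S)))

  separates⇒xtdFinite : (∃ λ n → Separates n 𝓛) → XTDFinite 𝓛
  separates⇒xtdFinite (n , sep) = n , λ L → upTo n , ≤-reflexive (length-upTo n) ,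
    λ j j' agree agree' → sep j j' λ x x<n →
      ⇔-trans (⇔-sym (agree x (∈-upTo⁺ x<n))) (agree' x (∈-upTo⁺ x<n))

  xtdFinite⇔separates : XTDFinite 𝓛 ⇔ (∃ λ n → Separates n 𝓛)
  xtdFinite⇔separates = mk⇔ xtdFinite⇒separates separates⇒xtdFinite

-- Approximating separation by finite stages

module Stages (em : ExcludedMiddle 0ℓ) (H : ℕ → ℕ → ℕ → Set)
  (mono : ∀ {j u s s'} → s ≤ s' → H j u s → H j u s') where

  Enumerated : ℕ → ℕ → Set
  Enumerated j u = ∃ λ s → H j u s

  Differ : ℕ → ℕ → ℕ → ℕ → Set
  Differ j j' v s = (H j v s × ¬ H j' v s) ⊎ (¬ H j v s × H j' v s)

  -- At some stage `s` past `w`, the element `u` is not a visible counterexample to "agreement below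
  -- `n` implies inclusion of language `j` in language `j'`". Letting `w` vary asks for infinitely
  -- many such stages; both orders of `j` and `j'` occur, so one inclusion suffices.
  Refuted : ℕ → (ℕ × ℕ) × (ℕ × ℕ) → ℕ × ℕ → Set
  Refuted n ((j , j') , (u , w)) (s , v) =
    w ≤ s × ((v < n × Differ j j' v s) ⊎ (¬ H j u s ⊎ H j' u s))

  -- Only finitely many elements lie below `n`: those in both languages have all appeared by some
  -- stage, and the others never appear.
  settled : ∀ j j' n → Agree n (Enumerated j) (Enumerated j') →
            ∃ λ s₀ → ∀ v s → v < n → s₀ ≤ s → ¬ Differ j j' v s
  settled j j' zero    agree = 0 , λ _ _ ()
  settled j j' (suc n) agree with settled j j' n (λ x x<n → agree x (m<n⇒m<1+n x<n))
  ... | s₀ , below with em {Enumerated j n}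
  ...   | yes (s₁ , h₁) = let s₂ , h₂ = to (agree n ≤-refl) (s₁ , h₁) in
    s₀ ⊔ (s₁ ⊔ s₂) , λ v s v<1+n ≤s → case m≤n⇒m<n∨m≡n (≤-pred v<1+n) of λ where
      (inj₁ v<n) d → below v s v<n (≤-trans (m≤m⊔n s₀ (s₁ ⊔ s₂)) ≤s) d
      (inj₂ refl) (inj₁ (_ , ¬h)) →
        ¬h (mono (≤-trans (m≤n⊔m s₁ s₂) (≤-trans (m≤n⊔m s₀ (s₁ ⊔ s₂)) ≤s)) h₂)
      (inj₂ refl) (inj₂ (¬h , _)) →
        ¬h (mono (≤-trans (m≤m⊔n s₁ s₂) (≤-trans (m≤n⊔m s₀ (s₁ ⊔ s₂)) ≤s)) h₁)
  ...   | no ¬enum = s₀ , λ v s v<1+n ≤s → case m≤n⇒m<n∨m≡n (≤-pred v<1+n) of λ where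
      (inj₁ v<n) d → below v s v<n ≤s d
      (inj₂ refl) (inj₁ (h , _)) → ¬enum (s , h)
      (inj₂ refl) (inj₂ (_ , h)) → ¬enum (from (agree n ≤-refl) (s , h))

  -- A true difference below `n` shows at all late stages. Without one, separation gives equal
  -- languages, so `u` either never enters the first or eventually enters the second.
  separates⇒refuted : ∀ {n} → Separates n Enumerated → ∀ y → ∃ λ z → Refuted n y z
  separates⇒refuted {n} sep ((j , j') , (u , w)) with em {∃ λ v → v < n ×
    ((Enumerated j v × ¬ Enumerated j' v) ⊎ (¬ Enumerated j v × Enumerated j' v))}
  ... | yes (v , v<n , inj₁ ((s , h) , ¬e)) =
    (w ⊔ s , v) , m≤m⊔n w s , inj₁ (v<n , inj₁ (mono (m≤n⊔m w s) h , λ h' → ¬e (w ⊔ s , h')))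
  ... | yes (v , v<n , inj₂ (¬e , (s , h))) =
    (w ⊔ s , v) , m≤m⊔n w s , inj₁ (v<n , inj₂ ((λ h' → ¬e (w ⊔ s , h')) , mono (m≤n⊔m w s) h))
  ... | no none with em {Enumerated j u}
  -- The 0 is a default for `v`, which the chosen disjunct does not mention.
  ...   | no ¬e = (w , 0) , ≤-refl , inj₂ (inj₁ λ h → ¬e (w , h))
  ...   | yes e = let s , h = to (sep j j' agree u) e in
    (w ⊔ s , 0) , m≤m⊔n w s , inj₂ (inj₂ (mono (m≤n⊔m w s) h))
    where
    agree : Agree n (Enumerated j) (Enumerated j')
    agree v v<n = mk⇔ (λ e → stable em λ ¬e' → none (v , v<n , inj₁ (e , ¬e')))
                      (λ e' → stable em λ ¬e → none (v , v<n , inj₂ (¬e , e')))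

  refuted⇒separates : ∀ {n} → (∀ y → ∃ λ z → Refuted n y z) → Separates n Enumerated
  refuted⇒separates {n} refuted j j' agree u =
    mk⇔ (included j j' agree) (included j' j λ x x<n → ⇔-sym (agree x x<n))
    where
    included : ∀ j j' → Agree n (Enumerated j) (Enumerated j') → Enumerated j u → Enumerated j' u
    included j j' agree (s₁ , h₁) with settled j j' n agree
    -- The bound lies past the entry of `u` into language `j` and past the last visible difference
    -- below `n`, which leaves only the entry of `u` into language `j'`.
    ... | s₀ , same with refuted ((j , j') , (u , s₁ ⊔ s₀))
    ...   | (s , v) , ≤s , inj₁ (v<n , d)    = contradiction d (same v s v<n (≤-trans (m≤n⊔m s₁ s₀) ≤s))
    ...   | (s , v) , ≤s , inj₂ (inj₁ ¬h)    = contradiction (mono (≤-trans (m≤m⊔n s₁ s₀) ≤s) h₁) ¬h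
    ...   | (s , v) , ≤s , inj₂ (inj₂ h)     = s , h

  separates⇔refuted : ∀ n → Separates n Enumerated ⇔ (∀ y → ∃ λ z → Refuted n y z)
  separates⇔refuted n = mk⇔ separates⇒refuted refuted⇒separates

-- Families of initial segments

module Segments (em : ExcludedMiddle 0ℓ) (E : ℕ → ℕ → Set) where

  -- For `y < j` the truncated difference is 0 and the condition on `b` is vacuous, which puts all
  -- of [0, `j`) into the language.
  Segment : ℕ → ℕ → Set
  Segment j y = ∃ λ a → a < suc j × (∀ b → b < suc y ∸ j → E a b)

  segment-initial : ∀ {j y} → y < j → Segment j y
  segment-initial {j} {y} y<j = 0 , s≤s z≤n , λ b b< →
    contradiction (subst (b <_) (m≤n⇒m∸n≡0 y<j) b<) λ ()

  segment-downward : ∀ {j x y} → x ≤ y → Segment j y → Segment j x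
  segment-downward {j} x≤y (a , a≤j , full) =
    a , a≤j , λ b b< → full b (≤-trans b< (∸-monoˡ-≤ j (s≤s x≤y)))

  FullOrMisses : ℕ → ℕ → Set
  FullOrMisses n j = (∀ y → Segment j y) ⊎ (∃ λ y → y < n × ¬ Segment j y)

  full-or-misses : ∀ k → ∃ λ n → ∀ j → j < k → FullOrMisses n j
  full-or-misses zero    = 0 , λ _ ()
  full-or-misses (suc k) with full-or-misses k | em {∃ λ y → ¬ Segment k y}
  ... | n , below | yes (y , ¬s) = n ⊔ suc y , λ j j<1+k → case m≤n⇒m<n∨m≡n (≤-pred j<1+k) of λ where
    (inj₁ j<k)  → case below j j<k of λ where
      (inj₁ full) → inj₁ full
      (inj₂ (y' , y'<n , ¬s')) → inj₂ (y' , ≤-trans y'<n (m≤m⊔n n (suc y)) , ¬s')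
    (inj₂ refl) → inj₂ (y , m≤n⊔m n (suc y) , ¬s)
  ... | n , below | no none = n , λ j j<1+k → case m≤n⇒m<n∨m≡n (≤-pred j<1+k) of λ where
    (inj₁ j<k)  → below j j<k
    (inj₂ refl) → inj₁ λ y → stable em λ ¬s → none (y , ¬s)

  -- All indices from `a` on give ℕ. Of the finitely many others, each gives ℕ or misses a point
  -- below `n`, so initial segments that agree below `n` are both full or both end there.
  all⇒separates : (∃ λ a → ∀ b → E a b) → ∃ λ n → Separates n Segment
  all⇒separates (a , full-a) = n , λ j j' agree x →
    mk⇔ (included j j' agree) (included j' j λ y y<n → ⇔-sym (agree y y<n))
    where
    n = proj₁ (full-or-misses a)

    classify : ∀ j → FullOrMisses n j
    classify j = case <-≤-connex j a of λ where
      (inj₁ j<a) → proj₂ (full-or-misses a) j j<a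
      (inj₂ a≤j) → inj₁ λ y → a , s≤s a≤j , λ b _ → full-a b

    included : ∀ j j' → Agree n (Segment j) (Segment j') → ∀ {x} → Segment j x → Segment j' x
    included j j' agree {x} s with <-≤-connex x n | classify j | classify j'
    ... | inj₁ x<n | _ | _ = to (agree x x<n) s
    ... | inj₂ n≤x | _ | inj₁ full' = full' x
    ... | inj₂ n≤x | inj₁ full | inj₂ (y , y<n , ¬s') = contradiction (to (agree y y<n) (full y)) ¬s'
    ... | inj₂ n≤x | inj₂ (y , y<n , ¬s) | _ =
      contradiction (segment-downward (≤-trans (<⇒≤ y<n) n≤x) s) ¬s

  counterexamples-bounded : (∀ a → ∃ λ b → ¬ E a b) →
    ∀ k → ∃ λ m → ∀ a → a < k → ∃ λ b → b < m × ¬ E a b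
  counterexamples-bounded missing zero    = 0 , λ _ ()
  counterexamples-bounded missing (suc k) with counterexamples-bounded missing k | missing k
  ... | m , below | b , ¬e = m ⊔ suc b , λ a a<1+k → case m≤n⇒m<n∨m≡n (≤-pred a<1+k) of λ where
    (inj₁ a<k)  → let b' , b'<m , ¬e' = below a a<k in b' , ≤-trans b'<m (m≤m⊔n m (suc b)) , ¬e'
    (inj₂ refl) → b , m≤n⊔m m (suc b) , ¬e

  separates⇒all : (∃ λ n → Separates n Segment) → ∃ λ a → ∀ b → E a b
  separates⇒all (n , sep) = stable em λ none →
    let m , bounded = counterexamples-bounded
          (λ a → stable em λ ¬∃ → none (a , λ b → stable em λ ¬e → ¬∃ (b , ¬e))) (suc n)
        -- Segments `n` and `j` both contain [0, `n`), hence are equal. As `n + m` lies in segment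
        -- `j`, it lies in segment `n`, so some `a ≤ n` satisfies `E a b` for all `b ≤ m`; but `m`
        -- bounds a counterexample for each such `a`.
        j = suc (n + m)
        a , a≤n , full = from (sep n j
          (λ x x<n → mk⇔ (λ _ → segment-initial (≤-trans x<n (≤-trans (m≤m+n n m) (n≤1+n (n + m)))))
                         (λ _ → segment-initial x<n)) (n + m)) (segment-initial ≤-refl)
        b , b<m , ¬e = bounded a a≤n
    in ¬e (full b (≤-trans b<m (≤-trans (n≤1+n m)
         (≤-reflexive (sym (trans (cong (_∸ n) (sym (+-suc n m))) (m+n∸m≡n n (suc m))))))))

  all⇔separates : (∃ λ a → ∀ b → E a b) ⇔ (∃ λ n → Separates n Segment)
  all⇔separates = mk⇔ all⇒separates separates⇒all

-- Completeness

open Compactness using (xtdFinite⇔separates)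

-- The recursive relation is the zero set of the underlying program, which is defined on all numbers
-- and decides `P` on encoded quadruples.
Σ⁰₃-intro : ∀ {ℓ} {A : ℕ → Set ℓ} {P : El (nat ⊗ nat ⊗ nat ⊗ nat) → Set} → Decider P →
            (∀ e → A e ⇔ (∃ λ x → ∀ y → ∃ λ z → P (e , x , y , z))) → Σ⁰₃ A
Σ⁰₃-intro {P = P} P? A⇔ =
  (λ w → raw (tot (test P?)) w ≡ 0) ,
  (raw (tot (test P?)) , recursive , λ _ → ⇔-refl) ,
  λ e → ⇔-trans (A⇔ e) (∃-⇔ λ x → ∀-⇔ λ y → ∃-⇔ λ z → raw⇔ e x y z)
  where
  recursive : Recursive (raw (tot (test P?)))
  recursive = let c , eq = decode-surjective (code (tot (test P?))) in
    c , λ x → subst (λ c → Eval c x (raw (tot (test P?)) x)) (sym eq) (runs (tot (test P?)) x)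

  raw⇔ : ∀ e x y z → P (e , x , y , z) ⇔ (raw (tot (test P?)) ⟨ e , ⟨ x , ⟨ y , z ⟩ ⟩ ⟩ ≡ 0)
  raw⇔ e x y z = subst (λ k → P (e , x , y , z) ⇔ (k ≡ 0))
    (sym (ok (test P?) (e , x , y , z))) (dec P? (e , x , y , z))

quadrupleF : Fn nat ((nat ⊗ nat) ⊗ (nat ⊗ nat))
quadrupleF = (unpairF ∙ fstF ,F unpairF ∙ sndF) ∙ unpairF

quadruple-enc : ∀ y → fn quadrupleF (enc y) ≡ y
quadruple-enc ((j , j') , (u , w)) rewrite unpair-pair ⟨ j , j' ⟩ ⟨ u , w ⟩ =
  cong₂ _,_ (unpair-pair j j') (unpair-pair u w)

-- `Σ⁰₃` quantifies over numbers, so the tuples are coded; every tuple has a code.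
numeric-∀∃ : (Q : (ℕ × ℕ) × (ℕ × ℕ) → ℕ × ℕ → Set) →
  (∀ y → ∃ λ z → Q y z) ⇔ (∀ y → ∃ λ z → Q (fn quadrupleF y) (unpair z))
numeric-∀∃ Q = mk⇔ encoded decoded
  where
  encoded : (∀ y → ∃ λ z → Q y z) → ∀ y → ∃ λ z → Q (fn quadrupleF y) (unpair z)
  encoded h y with h (fn quadrupleF y)
  ... | (s , v) , p = ⟨ s , v ⟩ , subst (Q (fn quadrupleF y)) (sym (unpair-pair s v)) p

  decoded : (∀ y → ∃ λ z → Q (fn quadrupleF y) (unpair z)) → ∀ y → ∃ λ z → Q y z
  decoded h y with h (enc y)
  ... | z , p = unpair z , subst (λ y → Q y (unpair z)) (quadruple-enc y) p

-- Definability by a Σ⁰₃ formula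

module UpperBound (em : ExcludedMiddle 0ℓ) (φ : Numbering) (t : ℕ → ℕ) (t-recursive : Recursive t)
                  (φ⇔ : ∀ e x y → φ e x y ⇔ φStd (t e) x y) where

  ListedBy : ℕ → ℕ → ℕ → ℕ → Set
  ListedBy e j u s = HaltsWithin s (t e) ⟨ j , u ⟩

  listedBy? : Decider {nat ⊗ nat ⊗ nat ⊗ nat} (λ (e , j , u , s) → ListedBy e j u s)
  listedBy? = pullback (run ∙ (evaluateF nilF (recursiveF t t-recursive ∙ fstF)
                                 (npairF (fstF ∙ sndF) (fstF ∙ sndF ∙ sndF))
                               ,F sndF ∙ sndF ∙ sndF))
                       (record { test = halted ; dec = λ _ → ⇔-refl })

  module Listing e = Stages em (ListedBy e)
    (λ {j} {u} {s} {s'} → haltsWithin-mono {s} {s'} {t e} {⟨ j , u ⟩})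
  open Listing

  lang⇔enumerated : ∀ e j u → Lang φ e j u ⇔ Enumerated e j u
  lang⇔enumerated e j u = ⇔-trans (∃-⇔ (φ⇔ e ⟨ j , u ⟩)) (halts⇔ (t e) ⟨ j , u ⟩)

  refuted? : Decider {nat ⊗ nat ⊗ ((nat ⊗ nat) ⊗ (nat ⊗ nat)) ⊗ (nat ⊗ nat)}
               (λ (e , n , y , z) → Refuted e n y z)
  refuted? =
    pullback (w ,F s) ≤D ∧D
    ((pullback (sucF ∙ v ,F n) ≤D ∧D
       ((listed j v ∧D ¬D listed j' v) ∨D (¬D listed j v ∧D listed j' v)))
     ∨D (¬D listed j u ∨D listed j' u))
    where
    e n j j' u w s v : Fn (nat ⊗ nat ⊗ ((nat ⊗ nat) ⊗ (nat ⊗ nat)) ⊗ (nat ⊗ nat)) nat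
    e  = fstF
    n  = fstF ∙ sndF
    j  = fstF ∙ fstF ∙ fstF ∙ sndF ∙ sndF
    j' = sndF ∙ fstF ∙ fstF ∙ sndF ∙ sndF
    u  = fstF ∙ sndF ∙ fstF ∙ sndF ∙ sndF
    w  = sndF ∙ sndF ∙ fstF ∙ sndF ∙ sndF
    s  = fstF ∙ sndF ∙ sndF ∙ sndF
    v  = sndF ∙ sndF ∙ sndF ∙ sndF
    listed : (i x : Fn _ nat) → Decider _
    listed i x = pullback (e ,F i ,F x ,F s) listedBy?

  I-XTD⇔ : ∀ e → I-XTD φ e ⇔ (∃ λ n → ∀ y → ∃ λ z → Refuted e n (fn quadrupleF y) (unpair z))
  I-XTD⇔ e = ⇔-trans (xtdFinite⇔separates em (Lang φ e)) (∃-⇔ λ n →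
    ⇔-trans (separates-⇔ (lang⇔enumerated e))
      (⇔-trans (separates⇔refuted e n) (numeric-∀∃ (Refuted e n))))

  I-XTD-Σ⁰₃ : Σ⁰₃ (I-XTD φ)
  I-XTD-Σ⁰₃ = Σ⁰₃-intro
    (pullback (fstF ,F fstF ∙ sndF ,F quadrupleF ∙ fstF ∙ sndF ∙ sndF ,F unpairF ∙ sndF ∙ sndF ∙ sndF)
              refuted?)
    I-XTD⇔

-- Collection: finitely many witnesses have a common bound, so the bounded universal quantifier
-- moves inside a single unbounded search.
bounded-witnesses : ∀ {P : ℕ → ℕ → Set} m →
  (∀ b → b < m → ∃ λ c → P b c) ⇔ (∃ λ z → ∀ b → b < m → ∃ λ c → c < z × P b c)
bounded-witnesses {P} m = mk⇔ (collect m) λ (z , h) b b<m → let c , _ , p = h b b<m in c , p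
  where
  collect : ∀ m → (∀ b → b < m → ∃ λ c → P b c) → ∃ λ z → ∀ b → b < m → ∃ λ c → c < z × P b c
  collect zero    h = 0 , λ _ ()
  collect (suc m) h =
    let z , below = collect m λ b b<m → h b (m<n⇒m<1+n b<m)
        c , p     = h m ≤-refl
    in z ⊔ suc c , λ b b<1+m → case m≤n⇒m<n∨m≡n (≤-pred b<1+m) of λ where
      (inj₁ b<m)  → let c' , c'<z , p' = below b b<m in c' , ≤-trans c'<z (m≤m⊔n z (suc c)) , p'
      (inj₂ refl) → c , m≤n⊔m z (suc c) , p

-- Reducing an arbitrary Σ⁰₃ set

module Hardness (em : ExcludedMiddle 0ℓ) (φ : Numbering) (s : ℕ → ℕ) (s-recursive : Recursive s)
                (⇔φ : ∀ e x y → φStd e x y ⇔ φ (s e) x y)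
                {R : ℕ → Set} (R-recursive : RecursiveSet R) where

  Matrix : El (nat ⊗ nat ⊗ nat ⊗ nat) → Set
  Matrix w = R (enc w)

  matrix? : Decider Matrix
  matrix? = let χ , χ-recursive , R⇔ = R-recursive in
    record { test = recursiveF χ χ-recursive ; dec = λ w → R⇔ (enc w) }

  Row : ℕ → ℕ → ℕ → Set
  Row x a b = ∃ λ c → Matrix (x , a , b , c)

  module Rows x = Segments em (Row x)
  open Rows

  -- `Segment` with all witnesses `c` bounded by `z`: this is decidable, so membership in a segment
  -- becomes a search for `z`.
  Staged : El ((nat ⊗ nat ⊗ nat) ⊗ nat) → Set
  Staged ((x , j , y) , z) = ∃ λ a → a < suc j ×
    (∀ b → b < suc y ∸ j → ∃ λ c → c < z × Matrix (x , a , b , c))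

  staged? : Decider Staged
  staged? = pullback (idF ,F sucF ∙ fstF ∙ sndF ∙ fstF) (anyBelow
    (pullback (idF ,F monusF ∙ (sucF ∙ sndF ∙ sndF ,F fstF ∙ sndF) ∙ fstF ∙ fstF) (allBelow
      (pullback (idF ,F sndF ∙ fstF ∙ fstF) (anyBelow
        (pullback (fstF ∙ fstF ∙ fstF ∙ fstF ∙ fstF
                   ,F sndF ∙ fstF ∙ fstF ,F sndF ∙ fstF ,F sndF) matrix?))))))

  staged⇔segment : ∀ x j y → (∃ λ z → Staged ((x , j , y) , z)) ⇔ Segment x j y
  staged⇔segment x j y = mk⇔
    (λ (z , a , a≤j , h) → a , a≤j , from (bounded-witnesses (suc y ∸ j)) (z , h))
    (λ (a , a≤j , h) → let z , h' = to (bounded-witnesses (suc y ∸ j)) h in z , a , a≤j , h')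

  q : ℕ
  q = proj₁ (decode-surjective (searchCode staged?))

  -- The s-m-n function fixes `x` in the search program, and `s` translates the resulting standard
  -- index into one for `φ`.
  reduction : Fn nat nat
  reduction = recursiveF s s-recursive ∙ smnF q

  lang⇔segment : ∀ x j y → Lang φ (fn reduction x) j y ⇔ Segment x j y
  lang⇔segment x j y =
    ⇔-trans (∃-⇔ λ v → ⇔-trans (⇔-sym (⇔φ (smn q x) ⟨ j , y ⟩ v)) (smn-eval⇔ q x ⟨ j , y ⟩ v))
    (⇔-trans (subst (λ c → (∃ λ v → Eval c ⟨ x , ⟨ j , y ⟩ ⟩ v) ⇔ (∃ λ z → Staged ((x , j , y) , z)))
               (sym (proj₂ (decode-surjective (searchCode staged?))))
               (searchCode-halts⇔ staged? (x , j , y)))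
             (staged⇔segment x j y))

  reduction-correct : ∀ x → (∃ λ a → ∀ b → ∃ λ c → Matrix (x , a , b , c)) ⇔ I-XTD φ (fn reduction x)
  reduction-correct x = ⇔-trans (all⇔separates x)
    (⇔-trans (∃-⇔ λ n → separates-⇔ (λ j y → ⇔-sym (lang⇔segment x j y)))
             (⇔-sym (xtdFinite⇔separates em (Lang φ (fn reduction x)))))

theorem7 : ExcludedMiddle 0ℓ → ExcludedMiddle (lsuc 0ℓ) →
    (φ : Numbering) → Acceptable φ →
    Σ⁰₃-complete (I-XTD φ)
theorem7 em _ φ ((t , t-recursive , φ⇔) , (s , s-recursive , ⇔φ)) =
  I-XTD-Σ⁰₃ , λ B (R , R-recursive , B⇔) →
    let open Hardness em φ s s-recursive ⇔φ R-recursive in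
    fn reduction , fn-recursive reduction , λ x → ⇔-trans (B⇔ x) (reduction-correct x)
  where open UpperBound em φ t t-recursive φ⇔
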